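{- Let $\Delta$ be a finite simplicial complex of dimension $d-1$ (with $d\ge 1$), with vertex set $V(\Delta)$ and $h$-polynomial $h(w)$. Then $$h'(w)=\frac{1}{1-w}\left(\sum_{p\in V(\Delta)}h_{\mathrm{lk}_\Delta(p)}(w)-d\,h(w)\right).$$
   Context: For a finite simplicial complex $X$, its $f$-polynomial is $f_X(t)=\sum_{F\in X}t^{|F|}$ (the empty face included). The link of a vertex $p$ of $\Delta$ is $\mathrm{lk}_\Delta(p)=\{G: G\cup\{p\}\in\Delta,\ p\notin G\}$. With $f=f_\Delta$, the $h$-polynomial $h=h_\Delta$ is defined by $(v-1)^d f\!\left(\frac1{v-1}\right)=v^d h\!\left(\frac1v\right)$, equivalently $h(w)=(1-w)^d f\!\left(\frac{w}{1-w}\right)$. The $h$-polynomial of a vertex link is taken with respect to $d-1$: $(v-1)^{d-1}f_{\mathrm{lk}_\Delta(p)}\!\left(\frac1{v-1}\right)=v^{d-1}h_{\mathrm{lk}_\Delta(p)}\!\left(\frac1v\right)$ (this is the usual $h$-polynomial of the link whenever the link has dimension $d-2$, e.g. when $\Delta$ is pure). -}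

module Defs where

open import Algebra.Bundles using (CommutativeRing; CommutativeSemiring)
import Algebra.Properties.Semiring.Exp as Exp
import Algebra.Solver.Ring.NaturalCoefficients.Default as Solver
import Data.Empty as Empty
open import Data.Fin.Base using (Fin)
open import Data.Fin.Subset using (Subset; ⊥; ⁅_⁆; _⊆_; _∉_; _∪_; ∣_∣; inside; outside)
import Data.Fin.Subset.Properties as Sub
open import Data.Integer.Base as ℤ using (ℤ; 0ℤ; 1ℤ)
import Data.Integer.Properties as ℤ
open import Data.Integer.Tactic.RingSolver using (solve-∀)
open import Data.List.Base using (List; []; _∷_; [_]; map; filter; foldr; allFin; _++_; length)
open import Data.List.Relation.Unary.All as All using (All; []; _∷_)
open import Data.List.Relation.Unary.All.Properties using (all-filter)
open import Data.List.Properties using (length-map)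
open import Data.Nat.Base as ℕ using (ℕ; zero; suc; _∸_; z≤n; s≤s)
import Data.Nat.Properties as ℕ
open import Data.Product.Base using (∃; ∃-syntax; _×_; _,_)
open import Data.Sum.Base using (inj₁; inj₂)
open import Data.Vec.Base using ([]; _∷_)
open import Level using (0ℓ)
open import Relation.Binary.PropositionalEquality as ≡ using (_≡_)
open import Relation.Nullary using (¬_; Dec; yes; no)
open import Relation.Nullary.Decidable using (_×-dec_; ¬?)
open import Relation.Unary using (Pred; Decidable)

-- ℤ[w]: lists of coefficients, constant term first, trailing zeros allowed.

module Polynomial where

  infix  4 _≈_
  infixl 6 _+_ _-_
  infixl 7 _*_ _·_
  infix  8 -_

  Poly : Set
  Poly = List ℤ

  coeff : Poly → ℕ → ℤ
  coeff []      _       = 0ℤ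
  coeff (a ∷ p) zero    = a
  coeff (a ∷ p) (suc k) = coeff p k

  record _≈_ (p q : Poly) : Set where
    constructor mk≈
    field coeff-≡ : ∀ k → coeff p k ≡ coeff q k
  open _≈_ public

  0# 1# X : Poly
  0# = []
  1# = [ 1ℤ ]
  X  = 0ℤ ∷ 1ℤ ∷ []

  _+_ : Poly → Poly → Poly
  []      + q       = q
  (a ∷ p) + []      = a ∷ p
  (a ∷ p) + (b ∷ q) = a ℤ.+ b ∷ p + q

  _·_ : ℤ → Poly → Poly
  a · p = map (a ℤ.*_) p

  -_ : Poly → Poly
  - p = map ℤ.-_ p

  _-_ : Poly → Poly → Poly
  p - q = p + - q

  _*_ : Poly → Poly → Poly
  []      * q = []
  (a ∷ p) * q = a · q + (0ℤ ∷ p * q)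

  -- (a + w p)′ = p + w p′
  derivative : Poly → Poly
  derivative []      = []
  derivative (a ∷ p) = p + (0ℤ ∷ derivative p)

  sumOver : ∀ {a} {A : Set a} → List A → (A → Poly) → Poly
  sumOver xs f = foldr (λ x s → f x + s) 0# xs

  ≈-refl : ∀ {p} → p ≈ p
  ≈-refl = mk≈ λ _ → ≡.refl

  ≈-sym : ∀ {p q} → p ≈ q → q ≈ p
  ≈-sym (mk≈ e) = mk≈ λ k → ≡.sym (e k)

  ≈-trans : ∀ {p q r} → p ≈ q → q ≈ r → p ≈ r
  ≈-trans (mk≈ e) (mk≈ f) = mk≈ λ k → ≡.trans (e k) (f k)

  coeff-+ : ∀ p q k → coeff (p + q) k ≡ coeff p k ℤ.+ coeff q k
  coeff-+ []      q       k       = ≡.sym (ℤ.+-identityˡ _)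
  coeff-+ (a ∷ p) []      k       = ≡.sym (ℤ.+-identityʳ _)
  coeff-+ (a ∷ p) (b ∷ q) zero    = ≡.refl
  coeff-+ (a ∷ p) (b ∷ q) (suc k) = coeff-+ p q k

  coeff-· : ∀ a p k → coeff (a · p) k ≡ a ℤ.* coeff p k
  coeff-· a []      k       = ≡.sym (ℤ.*-zeroʳ a)
  coeff-· a (b ∷ p) zero    = ≡.refl
  coeff-· a (b ∷ p) (suc k) = coeff-· a p k

  coeff-neg : ∀ p k → coeff (- p) k ≡ ℤ.- coeff p k
  coeff-neg []      k       = ≡.refl
  coeff-neg (b ∷ p) zero    = ≡.refl
  coeff-neg (b ∷ p) (suc k) = coeff-neg p k

  +-cong : ∀ {p p′ q q′} → p ≈ p′ → q ≈ q′ → p + q ≈ p′ + q′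
  +-cong {p} {p′} {q} {q′} (mk≈ e) (mk≈ f) = mk≈ λ k →
    ≡.trans (coeff-+ p q k) (≡.trans (≡.cong₂ ℤ._+_ (e k) (f k)) (≡.sym (coeff-+ p′ q′ k)))

  +-assoc : ∀ p q r → (p + q) + r ≈ p + (q + r)
  +-assoc p q r = mk≈ λ k → begin
    coeff ((p + q) + r) k                       ≡⟨ coeff-+ (p + q) r k ⟩
    coeff (p + q) k ℤ.+ coeff r k               ≡⟨ ≡.cong (ℤ._+ coeff r k) (coeff-+ p q k) ⟩
    (coeff p k ℤ.+ coeff q k) ℤ.+ coeff r k     ≡⟨ ℤ.+-assoc (coeff p k) _ _ ⟩
    coeff p k ℤ.+ (coeff q k ℤ.+ coeff r k)     ≡⟨ ≡.cong (λ z → coeff p k ℤ.+ z) (coeff-+ q r k) ⟨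
    coeff p k ℤ.+ coeff (q + r) k               ≡⟨ coeff-+ p (q + r) k ⟨
    coeff (p + (q + r)) k                       ∎
    where open ≡.≡-Reasoning

  +-comm : ∀ p q → p + q ≈ q + p
  +-comm p q = mk≈ λ k → ≡.trans (coeff-+ p q k)
    (≡.trans (ℤ.+-comm (coeff p k) (coeff q k)) (≡.sym (coeff-+ q p k)))

  +-identityˡ : ∀ p → 0# + p ≈ p
  +-identityˡ p = ≈-refl

  +-identityʳ : ∀ p → p + 0# ≈ p
  +-identityʳ p = +-comm p 0#

  neg-cong : ∀ {p q} → p ≈ q → - p ≈ - q
  neg-cong {p} {q} (mk≈ e) = mk≈ λ k →
    ≡.trans (coeff-neg p k) (≡.trans (≡.cong ℤ.-_ (e k)) (≡.sym (coeff-neg q k)))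

  +-inverseʳ : ∀ p → p - p ≈ 0#
  +-inverseʳ p = mk≈ λ k → ≡.trans (coeff-+ p (- p) k)
    (≡.trans (≡.cong (λ z → coeff p k ℤ.+ z) (coeff-neg p k)) (ℤ.+-inverseʳ (coeff p k)))

  +-inverseˡ : ∀ p → - p + p ≈ 0#
  +-inverseˡ p = ≈-trans (+-comm (- p) p) (+-inverseʳ p)

  +-exchange : ∀ p q r s → (p + q) + (r + s) ≈ (p + r) + (q + s)
  +-exchange p q r s = mk≈ λ k → begin
    coeff ((p + q) + (r + s)) k                                      ≡⟨ expand p q r s k ⟩
    (coeff p k ℤ.+ coeff q k) ℤ.+ (coeff r k ℤ.+ coeff s k)          ≡⟨ swap (coeff p k) (coeff q k) (coeff r k) (coeff s k) ⟩
    (coeff p k ℤ.+ coeff r k) ℤ.+ (coeff q k ℤ.+ coeff s k)          ≡⟨ expand p r q s k ⟨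
    coeff ((p + r) + (q + s)) k                                      ∎
    where
    open ≡.≡-Reasoning
    expand : ∀ p q r s k → coeff ((p + q) + (r + s)) k ≡
             (coeff p k ℤ.+ coeff q k) ℤ.+ (coeff r k ℤ.+ coeff s k)
    expand p q r s k = ≡.trans (coeff-+ (p + q) (r + s) k)
      (≡.cong₂ ℤ._+_ (coeff-+ p q k) (coeff-+ r s k))
    swap : ∀ a b c d → (a ℤ.+ b) ℤ.+ (c ℤ.+ d) ≡ (a ℤ.+ c) ℤ.+ (b ℤ.+ d)
    swap = solve-∀

  ∷-cong : ∀ {a b p q} → a ≡ b → p ≈ q → a ∷ p ≈ b ∷ q
  ∷-cong a≡b (mk≈ e) = mk≈ λ { zero → a≡b ; (suc k) → e k }

  tail-≈ : ∀ {a b p q} → a ∷ p ≈ b ∷ q → p ≈ q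
  tail-≈ (mk≈ e) = mk≈ λ k → e (suc k)

  0∷-≈0 : ∀ {p} → p ≈ 0# → 0ℤ ∷ p ≈ 0#
  0∷-≈0 (mk≈ e) = mk≈ λ { zero → ≡.refl ; (suc k) → e k }

  ·-cong : ∀ {a b p q} → a ≡ b → p ≈ q → a · p ≈ b · q
  ·-cong {a} {p = p} {q} ≡.refl (mk≈ e) = mk≈ λ k →
    ≡.trans (coeff-· a p k) (≡.trans (≡.cong (a ℤ.*_) (e k)) (≡.sym (coeff-· a q k)))

  0·-≈0 : ∀ p → 0ℤ · p ≈ 0#
  0·-≈0 p = mk≈ λ k → coeff-· 0ℤ p k

  1·-≈ : ∀ p → 1ℤ · p ≈ p
  1·-≈ p = mk≈ λ k → ≡.trans (coeff-· 1ℤ p k) (ℤ.*-identityˡ _)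

  ·-distribʳ : ∀ a b p → (a ℤ.+ b) · p ≈ a · p + b · p
  ·-distribʳ a b p = mk≈ λ k → begin
    coeff ((a ℤ.+ b) · p) k                    ≡⟨ coeff-· (a ℤ.+ b) p k ⟩
    (a ℤ.+ b) ℤ.* coeff p k                    ≡⟨ ℤ.*-distribʳ-+ (coeff p k) a b ⟩
    a ℤ.* coeff p k ℤ.+ b ℤ.* coeff p k        ≡⟨ ≡.cong₂ ℤ._+_ (coeff-· a p k) (coeff-· b p k) ⟨
    coeff (a · p) k ℤ.+ coeff (b · p) k        ≡⟨ coeff-+ (a · p) (b · p) k ⟨
    coeff (a · p + b · p) k                    ∎
    where open ≡.≡-Reasoning

  ·-distribˡ : ∀ a p q → a · (p + q) ≈ a · p + a · q
  ·-distribˡ a p q = mk≈ λ k → begin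
    coeff (a · (p + q)) k                      ≡⟨ coeff-· a (p + q) k ⟩
    a ℤ.* coeff (p + q) k                      ≡⟨ ≡.cong (a ℤ.*_) (coeff-+ p q k) ⟩
    a ℤ.* (coeff p k ℤ.+ coeff q k)            ≡⟨ ℤ.*-distribˡ-+ a _ _ ⟩
    a ℤ.* coeff p k ℤ.+ a ℤ.* coeff q k        ≡⟨ ≡.cong₂ ℤ._+_ (coeff-· a p k) (coeff-· a q k) ⟨
    coeff (a · p) k ℤ.+ coeff (a · q) k        ≡⟨ coeff-+ (a · p) (a · q) k ⟨
    coeff (a · p + a · q) k                    ∎
    where open ≡.≡-Reasoning

  ·-assoc : ∀ a b p → a · (b · p) ≈ (a ℤ.* b) · p
  ·-assoc a b p = mk≈ λ k → ≡.trans (coeff-· a (b · p) k)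
    (≡.trans (≡.cong (a ℤ.*_) (coeff-· b p k))
    (≡.trans (≡.sym (ℤ.*-assoc a b _)) (≡.sym (coeff-· (a ℤ.* b) p k))))

  *-congˡ : ∀ p {q q′} → q ≈ q′ → p * q ≈ p * q′
  *-congˡ []      e = ≈-refl
  *-congˡ (a ∷ p) e = +-cong (·-cong {a} ≡.refl e) (∷-cong ≡.refl (*-congˡ p e))

  *-zeroʳ : ∀ p → p * 0# ≈ 0#
  *-zeroʳ []      = ≈-refl
  *-zeroʳ (a ∷ p) = 0∷-≈0 (*-zeroʳ p)

  *-∷ʳ : ∀ p b q → p * (b ∷ q) ≈ b · p + (0ℤ ∷ p * q)
  *-∷ʳ []      b q = mk≈ λ { zero → ≡.refl ; (suc k) → ≡.refl }
  *-∷ʳ (a ∷ p) b q = ∷-cong (≡.cong (ℤ._+ 0ℤ) (ℤ.*-comm a b))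
    (≈-trans (+-cong ≈-refl (*-∷ʳ p b q))
    (≈-trans (≈-sym (+-assoc (a · q) (b · p) _))
    (≈-trans (+-cong (+-comm (a · q) (b · p)) ≈-refl)
             (+-assoc (b · p) (a · q) _))))

  *-comm : ∀ p q → p * q ≈ q * p
  *-comm []      q = ≈-sym (*-zeroʳ q)
  *-comm (a ∷ p) q = ≈-trans (+-cong ≈-refl (∷-cong ≡.refl (*-comm p q))) (≈-sym (*-∷ʳ q a p))

  *-cong : ∀ {p p′ q q′} → p ≈ p′ → q ≈ q′ → p * q ≈ p′ * q′
  *-cong {p} {p′} {q} {q′} e f = ≈-trans (*-congˡ p f)
    (≈-trans (*-comm p q′) (≈-trans (*-congˡ q′ e) (*-comm q′ p′)))

  *-distribʳ : ∀ r p q → (p + q) * r ≈ p * r + q * r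
  *-distribʳ r []      q       = ≈-refl
  *-distribʳ r (a ∷ p) []      = ≈-sym (+-identityʳ _)
  *-distribʳ r (a ∷ p) (b ∷ q) = ≈-trans
    (+-cong (·-distribʳ a b r) (∷-cong ≡.refl (*-distribʳ r p q)))
    (+-exchange (a · r) (b · r) (0ℤ ∷ p * r) (0ℤ ∷ q * r))

  *-distribˡ : ∀ r p q → r * (p + q) ≈ r * p + r * q
  *-distribˡ r p q = ≈-trans (*-comm r (p + q))
    (≈-trans (*-distribʳ r p q) (+-cong (*-comm p r) (*-comm q r)))

  ·-*-assoc : ∀ a p q → (a · p) * q ≈ a · (p * q)
  ·-*-assoc a []      q = ≈-refl
  ·-*-assoc a (b ∷ p) q = ≈-trans
    (+-cong (≈-sym (·-assoc a b q)) (∷-cong (≡.sym (ℤ.*-zeroʳ a)) (·-*-assoc a p q)))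
    (≈-sym (·-distribˡ a (b · q) (0ℤ ∷ p * q)))

  0∷-* : ∀ p q → (0ℤ ∷ p) * q ≈ 0ℤ ∷ p * q
  0∷-* p q = +-cong (0·-≈0 q) ≈-refl

  *-assoc : ∀ p q r → (p * q) * r ≈ p * (q * r)
  *-assoc []      q r = ≈-refl
  *-assoc (a ∷ p) q r = ≈-trans (*-distribʳ r (a · q) (0ℤ ∷ p * q))
    (+-cong (·-*-assoc a q r)
            (≈-trans (0∷-* (p * q) r) (∷-cong ≡.refl (*-assoc p q r))))

  *-identityˡ : ∀ p → 1# * p ≈ p
  *-identityˡ p = ≈-trans (+-cong (1·-≈ p) (0∷-≈0 (≈-refl {[]}))) (+-identityʳ p)

  *-identityʳ : ∀ p → p * 1# ≈ p
  *-identityʳ p = ≈-trans (*-comm p 1#) (*-identityˡ p)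

  commutativeRing : CommutativeRing 0ℓ 0ℓ
  commutativeRing = record
    { Carrier = Poly
    ; _≈_ = _≈_
    ; _+_ = _+_
    ; _*_ = _*_
    ; -_  = -_
    ; 0#  = 0#
    ; 1#  = 1#
    ; isCommutativeRing = record
      { isRing = record
        { +-isAbelianGroup = record
          { isGroup = record
            { isMonoid = record
              { isSemigroup = record
                { isMagma = record
                  { isEquivalence = record { refl = ≈-refl ; sym = ≈-sym ; trans = ≈-trans }
                  ; ∙-cong = +-cong
                  }
                ; assoc = +-assoc
                }
              ; identity = +-identityˡ , +-identityʳ
              }
            ; inverse = +-inverseˡ , +-inverseʳ
            ; ⁻¹-cong = neg-cong
            }
          ; comm = +-comm
          }
        ; *-cong = *-cong
        ; *-assoc = *-assoc
        ; *-identity = *-identityˡ , *-identityʳ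
        ; distrib = *-distribˡ , *-distribʳ
        }
      ; *-comm = *-comm
      }
    }

  open Exp (CommutativeRing.semiring commutativeRing) public using (_^_)

  -- ℤ[w] is an integral domain (compare lowest nonzero coefficients).
  *-≉0 : ∀ p q → ¬ p ≈ 0# → ¬ q ≈ 0# → ¬ p * q ≈ 0#
  *-≉0 []      q       p≉0 q≉0 _ = p≉0 ≈-refl
  *-≉0 (a ∷ p) []      p≉0 q≉0 _ = q≉0 ≈-refl
  *-≉0 (a ∷ p) (b ∷ q) p≉0 q≉0 pq≈0 =
    cases (a ℤ.≟ 0ℤ) (b ℤ.≟ 0ℤ) (*-≉0 p (b ∷ q)) (*-≉0 (a ∷ p) q)
    where
    cases : Dec (a ≡ 0ℤ) → Dec (b ≡ 0ℤ) →
            (¬ p ≈ 0# → ¬ b ∷ q ≈ 0# → ¬ p * (b ∷ q) ≈ 0#) →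
            (¬ a ∷ p ≈ 0# → ¬ q ≈ 0# → ¬ (a ∷ p) * q ≈ 0#) → Empty.⊥
    cases (yes ≡.refl) _ rec _ = rec (λ e → p≉0 (0∷-≈0 e)) q≉0
      (mk≈ λ k → coeff-≡ (≈-trans (≈-sym (0∷-* p (b ∷ q))) pq≈0) (suc k))
    cases (no _) (yes ≡.refl) _ rec = rec p≉0 (λ e → q≉0 (0∷-≈0 e))
      (mk≈ λ k → coeff-≡ (≈-trans (≈-sym shift) pq≈0) (suc k))
      where
      shift : (a ∷ p) * (0ℤ ∷ q) ≈ 0ℤ ∷ (a ∷ p) * q
      shift = ≈-trans (*-∷ʳ (a ∷ p) 0ℤ q) (+-cong (0·-≈0 (a ∷ p)) ≈-refl)
    cases (no a≢0) (no b≢0) _ _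
      with ℤ.i*j≡0⇒i≡0∨j≡0 a (≡.trans (≡.sym (ℤ.+-identityʳ (a ℤ.* b))) (coeff-≡ pq≈0 zero))
    ... | inj₁ a≡0 = a≢0 a≡0
    ... | inj₂ b≡0 = b≢0 b≡0

open Polynomial using (Poly; X; derivative; sumOver) public

-- The field of fractions of ℤ[w].

module RationalFunction where

  open Polynomial using (0#; 1#; *-≉0; coeff-≡)
  private module P = Polynomial

  infix  4 _≈_
  infixl 6 _+_
  infixl 7 _*_

  record RatFun : Set where
    constructor _/_[_]
    field
      num   : Poly
      den   : Poly
      den≉0 : ¬ den P.≈ 0#

  record _≈_ (r s : RatFun) : Set where
    constructor mk≈
    private
      module r = RatFun r
      module s = RatFun s
    field cross : r.num P.* s.den P.≈ s.num P.* r.den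

  1≉0 : ¬ 1# P.≈ 0#
  1≉0 e with coeff-≡ e 0
  ... | ()

  1-X≉0 : ¬ 1# P.- X P.≈ 0#
  1-X≉0 e with coeff-≡ e 0
  ... | ()

  ι : Poly → RatFun
  ι p = p / 1# [ 1≉0 ]

  _+_ : RatFun → RatFun → RatFun
  (a / b [ b≉0 ]) + (c / d [ d≉0 ]) = (a P.* d P.+ c P.* b) / (b P.* d) [ *-≉0 b d b≉0 d≉0 ]

  _*_ : RatFun → RatFun → RatFun
  (a / b [ b≉0 ]) * (c / d [ d≉0 ]) = (a P.* c) / (b P.* d) [ *-≉0 b d b≉0 d≉0 ]

  evaluate : Poly → RatFun → RatFun
  evaluate []      r = ι 0#
  evaluate (a ∷ p) r = ι [ a ] + r * evaluate p r

  1/⟨1-w⟩ w/⟨1-w⟩ : RatFun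
  1/⟨1-w⟩ = 1# / (1# P.- X) [ 1-X≉0 ]
  w/⟨1-w⟩ = X  / (1# P.- X) [ 1-X≉0 ]

open RationalFunction using (RatFun; ι; evaluate; 1/⟨1-w⟩; w/⟨1-w⟩) public

-- The vertices lie in Fin n; not every i : Fin n need be a vertex.
record SimplicialComplex (n : ℕ) : Set₁ where
  field
    Face        : Pred (Subset n) 0ℓ
    Face?       : Decidable Face
    empty-face  : Face ⊥
    down-closed : ∀ {F G} → G ⊆ F → Face F → Face G

  Vertex : Pred (Fin n) 0ℓ
  Vertex p = Face ⁅ p ⁆

  vertices : List (Fin n)
  vertices = filter (λ p → Face? ⁅ p ⁆) (allFin n)

open SimplicialComplex using (Vertex; vertices) public

subsets : ∀ n → List (Subset n)
subsets zero    = [ [] ]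
subsets (suc n) = map (outside ∷_) (subsets n) ++ map (inside ∷_) (subsets n)

faces : ∀ {n} → SimplicialComplex n → List (Subset n)
faces {n} Δ = filter (SimplicialComplex.Face? Δ) (subsets n)

HasDimension : ∀ {n} → SimplicialComplex n → ℕ → Set
HasDimension Δ e = (∃[ F ] Face F × ∣ F ∣ ≡ suc e) × (∀ F → Face F → ∣ F ∣ ℕ.≤ suc e)
  where open SimplicialComplex Δ

link : ∀ {n} (Δ : SimplicialComplex n) (p : Fin n) → Vertex Δ p → SimplicialComplex n
link Δ p v = record
  { Face        = λ G → Face (G ∪ ⁅ p ⁆) × p ∉ G
  ; Face?       = λ G → Face? (G ∪ ⁅ p ⁆) ×-dec ¬? (p Sub.∈? G)
  ; empty-face  = ≡.subst Face (≡.sym (Sub.∪-identityˡ ⁅ p ⁆)) v , Sub.∉⊥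
  ; down-closed = λ {F} {G} G⊆F (F∪p , p∉F) →
      down-closed (∪-mono G⊆F) F∪p , λ p∈G → p∉F (G⊆F p∈G)
  }
  where
  open SimplicialComplex Δ
  ∪-mono : ∀ {F G} → G ⊆ F → (G ∪ ⁅ p ⁆) ⊆ (F ∪ ⁅ p ⁆)
  ∪-mono {F} {G} G⊆F x∈ with Sub.x∈p∪q⁻ G ⁅ p ⁆ x∈
  ... | inj₁ x∈G = Sub.x∈p∪q⁺ (inj₁ (G⊆F x∈G))
  ... | inj₂ x∈p = Sub.x∈p∪q⁺ (inj₂ x∈p)

fPolynomial : ∀ {n} → SimplicialComplex n → Poly
fPolynomial Δ = sumOver (faces Δ) (λ F → X Polynomial.^ ∣ F ∣)

-- h(w) = (1-w)^d f(w/(1-w)) in the field of rational functions.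
IsHPolynomial : ∀ {n} → ℕ → SimplicialComplex n → Poly → Set
IsHPolynomial d Δ h =
  ι h RationalFunction.≈ ι ((1# - X) ^ d) RationalFunction.* evaluate (fPolynomial Δ) w/⟨1-w⟩
  where open Polynomial using (1#; _-_; _^_)

-- Such an h exists whenever no face has more than d elements; by link-bound
-- this covers both Δ and its links (the latter with d ∸ 1).

module HExistence where
  open Polynomial

  private
    S : CommutativeSemiring 0ℓ 0ℓ
    S = CommutativeRing.commutativeSemiring commutativeRing

    open Solver S using (solve; con; _:+_; _:*_; _:=_)

    step₁ : ∀ u → 0# * (1# * 1#) ≈ (u * 0#) * 1#
    step₁ u = ≈-sym (≈-trans (*-identityʳ (u * 0#)) (*-zeroʳ u))

    step₂ : ∀ a u x → a * (1# * (1# * (u * 1#))) ≈ (1# * (a * (u * 1#) + (x * 0#) * 1#)) * 1#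
    step₂ a u x = ≈-trans
      (solve 2 (λ a u → a :* (con 1 :* (con 1 :* (u :* con 1)))
          := (con 1 :* (a :* (u :* con 1) :+ con 0)) :* con 1) ≈-refl a u)
      (*-cong (*-congˡ 1# (+-cong (≈-refl {a * (u * 1#)})
        (≈-sym (≈-trans (*-identityʳ (x * 0#)) (*-zeroʳ x))))) ≈-refl)

    step₃ : ∀ a u v x h D → (a * (u * v) + x * h) * (1# * (1# * (u * D)))
              ≈ a * (u * v) * (u * D) + x * u * (h * (1# * D))
    step₃ = solve 6 (λ a u v x h D → (a :* (u :* v) :+ x :* h) :* (con 1 :* (con 1 :* (u :* D)))
              := a :* (u :* v) :* (u :* D) :+ x :* u :* (h :* (con 1 :* D))) ≈-refl

    step₄ : ∀ a u v x N D → a * (u * v) * (u * D) + x * u * ((v * N) * 1#)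
              ≈ ((u * v) * (a * (u * D) + (x * N) * 1#)) * 1#
    step₄ = solve 6 (λ a u v x N D → a :* (u :* v) :* (u :* D) :+ x :* u :* ((v :* N) :* con 1)
              := ((u :* v) :* (a :* (u :* D) :+ (x :* N) :* con 1)) :* con 1) ≈-refl

  hFrom : ℕ → Poly → Poly
  hFrom d       []      = 0#
  hFrom zero    (a ∷ p) = [ a ]
  hFrom (suc d) (a ∷ p) = [ a ] * (1# - X) ^ suc d + X * hFrom d p

  hFrom-spec : ∀ d p → length p ℕ.≤ suc d →
    ι (hFrom d p) RationalFunction.≈ ι ((1# - X) ^ d) RationalFunction.* evaluate p w/⟨1-w⟩
  hFrom-spec d [] _ = RationalFunction.mk≈ (step₁ ((1# - X) ^ d))
  hFrom-spec zero (a ∷ []) _ = RationalFunction.mk≈ (step₂ [ a ] (1# - X) X)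
  hFrom-spec zero (a ∷ b ∷ p) (s≤s ())
  hFrom-spec (suc d) (a ∷ p) (s≤s l) with evaluate p w/⟨1-w⟩ | hFrom-spec d p l
  ... | N RationalFunction./ D [ _ ] | RationalFunction.mk≈ ih = RationalFunction.mk≈
    (≈-trans (step₃ [ a ] u v X h D)
    (≈-trans (+-cong (≈-refl {[ a ] * (u * v) * (u * D)}) (*-congˡ (X * u) ih))
             (step₄ [ a ] u v X N D)))
    where
    u v h : Poly
    u = 1# - X
    v = (1# - X) ^ d
    h = hFrom d p

  length-+ : ∀ p q → length (p + q) ≡ length p ℕ.⊔ length q
  length-+ []      q       = ≡.refl
  length-+ (a ∷ p) []      = ≡.refl
  length-+ (a ∷ p) (b ∷ q) = ≡.cong suc (length-+ p q)

  length-X* : ∀ p → length (X * p) ℕ.≤ suc (1 ℕ.⊔ length p)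
  length-X* p = begin
    length (X * p)                                       ≡⟨ length-+ (0ℤ · p) _ ⟩
    length (0ℤ · p) ℕ.⊔ suc (length (1ℤ · p + (0ℤ ∷ []))) ≡⟨ ≡.cong₂ (λ m n → m ℕ.⊔ suc n)
                                                              (length-map (0ℤ ℤ.*_) p) (length-+ (1ℤ · p) _) ⟩
    length p ℕ.⊔ suc (length (1ℤ · p) ℕ.⊔ 1)             ≡⟨ ≡.cong (λ m → length p ℕ.⊔ suc (m ℕ.⊔ 1))
                                                              (length-map (1ℤ ℤ.*_) p) ⟩
    length p ℕ.⊔ suc (length p ℕ.⊔ 1)                    ≡⟨ ≡.cong (λ m → length p ℕ.⊔ suc m) (ℕ.⊔-comm (length p) 1) ⟩
    length p ℕ.⊔ suc (1 ℕ.⊔ length p)                    ≤⟨ ℕ.⊔-lub (ℕ.m≤n⇒m≤1+n (ℕ.m≤n⊔m 1 (length p))) ℕ.≤-refl ⟩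
    suc (1 ℕ.⊔ length p)                                 ∎
    where open ℕ.≤-Reasoning

  length-X^ : ∀ k → length (X ^ k) ℕ.≤ suc k
  length-X^ zero    = ℕ.≤-refl
  length-X^ (suc k) = ℕ.≤-trans (length-X* (X ^ k)) (s≤s (ℕ.⊔-lub (s≤s z≤n) (length-X^ k)))

  length-sumOver : ∀ {A : Set} (xs : List A) (f : A → Poly) m →
    All (λ x → length (f x) ℕ.≤ m) xs → length (sumOver xs f) ℕ.≤ m
  length-sumOver []       f m []       = z≤n
  length-sumOver (x ∷ xs) f m (l ∷ ls) = ℕ.≤-trans
    (ℕ.≤-reflexive (length-+ (f x) (sumOver xs f))) (ℕ.⊔-lub l (length-sumOver xs f m ls))

  hPolynomial-exists : ∀ {n} d (Δ : SimplicialComplex n) →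
    (∀ F → SimplicialComplex.Face Δ F → ∣ F ∣ ℕ.≤ d) → ∃ (IsHPolynomial d Δ)
  hPolynomial-exists {n} d Δ bound = hFrom d (fPolynomial Δ) , hFrom-spec d (fPolynomial Δ)
    (length-sumOver (faces Δ) _ (suc d)
      (All.map (λ {F} F∈Δ → ℕ.≤-trans (length-X^ ∣ F ∣) (s≤s (bound F F∈Δ)))
        (all-filter (SimplicialComplex.Face? Δ) (subsets n))))

  link-bound : ∀ {n} d (Δ : SimplicialComplex n) p (v : Vertex Δ p) →
    (∀ F → SimplicialComplex.Face Δ F → ∣ F ∣ ℕ.≤ d) →
    ∀ G → SimplicialComplex.Face (link Δ p v) G → ∣ G ∣ ℕ.≤ d ∸ 1
  link-bound d Δ p v bound G (G∪p∈Δ , p∉G) = ℕ.<⇒≤pred (ℕ.<-≤-trans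
    (Sub.p⊂q⇒∣p∣<∣q∣ (Sub.p⊆p∪q ⁅ p ⁆ , p , Sub.x∈p∪q⁺ (inj₂ (Sub.x∈⁅x⁆ p)) , p∉G))
    (bound (G ∪ ⁅ p ⁆) G∪p∈Δ))

{-# OPTIONS --safe #-}

-- The h-polynomial is a linear function of the f-polynomial: w^k contributes
-- w^k (1-w)^(d-k).  On each monomial, hence on all of f, this linear map T_d satisfies
-- (1-w) (T_d f)′ + d T_d f = T_(d-1) (f′), and f′ is the sum of the f-polynomials of
-- the vertex links, because a face F is counted |F| times when pairs p ∈ F are sent
-- to the face F \ p of the link of p.
module Submission where

open import Algebra.Bundles using (CommutativeRing)
import Algebra.Solver.Ring.NaturalCoefficients.Default as Solver
open import Data.Bool.Base using (true; false; if_then_else_)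
open import Data.Fin.Base using (Fin; zero; suc)
open import Data.Fin.Subset using (Subset; ⊥; ⁅_⁆; _∪_; ∣_∣; _∉_; inside; outside)
import Data.Fin.Subset.Properties as Sub
open import Data.Integer.Base using (+_; 0ℤ; -1ℤ)
import Data.Integer.Properties as ℤ
open import Data.List.Base using (List; []; _∷_; [_]; map; filter; allFin; _++_)
open import Data.List.Properties using (map-tabulate)
open import Data.Nat.Base using (ℕ; zero; suc; pred; _≤_; _∸_; s≤s)
open import Data.Product.Base using (_,_; proj₂)
open import Data.Vec.Base using ([]; _∷_; here; there)
open import Defs
open import Function.Base using (id; _∘_)
open import Level using (0ℓ)
open import Relation.Binary.PropositionalEquality as ≡ using (_≡_)
open import Relation.Nullary using (¬_; does; yes; no; contradiction)
open import Relation.Nullary.Decidable using (_×-dec_; ¬?; decidable-stable)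
open import Relation.Unary using (Pred; Decidable)

private
  module P where
    open Polynomial public
    open HExistence using (hFrom; hPolynomial-exists; link-bound) public
    open CommutativeRing commutativeRing using (commutativeSemiring; ring; setoid) public
    open Solver commutativeSemiring public using (solve; con; _:+_; _:*_; _:=_)
    open import Relation.Binary.Reasoning.Setoid setoid public
    open import Algebra.Properties.Ring ring using (x∙y⁻¹≈ε⇒x≈y; -‿distribˡ-*) public

-- Cancellation and formal differentiation in ℤ[w].

module PolynomialLemmas where
  open P

  -- Equality of integers is decidable, so a double negation can be removed coefficient by
  -- coefficient.
  ≈-stable : ∀ {p q} → ¬ ¬ p ≈ q → p ≈ q
  ≈-stable ¬¬e = mk≈ λ k → decidable-stable (_ ℤ.≟ _) λ ≢ → ¬¬e λ e → ≢ (coeff-≡ e k)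

  -- The domain property `*-≉0` is negative: it only refutes that `p - q` is nonzero. `≈-stable`
  -- turns this into an equation.
  *-cancelʳ : ∀ {p q} r → ¬ r ≈ 0# → p * r ≈ q * r → p ≈ q
  *-cancelʳ {p} {q} r r≉0 e = ≈-stable λ p≉q →
    *-≉0 (p - q) r (λ d → p≉q (x∙y⁻¹≈ε⇒x≈y p q d)) r≉0 (begin
      (p - q) * r        ≈⟨ *-distribʳ r p (- q) ⟩
      p * r + - q * r    ≈⟨ +-cong e (≈-sym (-‿distribˡ-* q r)) ⟩
      q * r - q * r      ≈⟨ +-inverseʳ (q * r) ⟩
      0#                 ∎)

  *-congʳ : ∀ r {p q} → p ≈ q → p * r ≈ q * r
  *-congʳ r e = *-cong e (≈-refl {r})

  [a]≈0 : ∀ {a} → a ≡ 0ℤ → [ a ] ≈ 0#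
  [a]≈0 ≡.refl = 0∷-≈0 (≈-refl {[]})

  [a]*p≈a·p : ∀ a p → [ a ] * p ≈ a · p
  [a]*p≈a·p a p = ≈-trans (+-cong ≈-refl (0∷-≈0 ≈-refl)) (+-identityʳ (a · p))

  X*p≈0∷p : ∀ p → X * p ≈ 0ℤ ∷ p
  X*p≈0∷p p = ≈-trans (0∷-* 1# p) (∷-cong ≡.refl (*-identityˡ p))

  [1-X]+X≈1 : (1# - X) + X ≈ 1#
  [1-X]+X≈1 = ≈-trans (+-assoc 1# (- X) X) (≈-trans (+-cong (≈-refl {1#}) (+-inverseˡ X)) ≈-refl)

  derivative-≈0 : ∀ p → p ≈ 0# → derivative p ≈ 0#
  derivative-≈0 []      e = ≈-refl
  derivative-≈0 (a ∷ p) e = +-cong p≈0 (0∷-≈0 (derivative-≈0 p p≈0))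
    where
    p≈0 : p ≈ 0#
    p≈0 = mk≈ λ k → coeff-≡ e (suc k)

  derivative-cong : ∀ p q → p ≈ q → derivative p ≈ derivative q
  derivative-cong []      q       e = ≈-sym (derivative-≈0 q (≈-sym e))
  derivative-cong (a ∷ p) []      e = derivative-≈0 (a ∷ p) e
  derivative-cong (a ∷ p) (b ∷ q) e =
    +-cong (tail-≈ e) (∷-cong ≡.refl (derivative-cong p q (tail-≈ e)))

  derivative-+ : ∀ p q → derivative (p + q) ≈ derivative p + derivative q
  derivative-+ []      q       = ≈-refl
  derivative-+ (a ∷ p) []      = ≈-sym (+-identityʳ _)
  derivative-+ (a ∷ p) (b ∷ q) = ≈-trans
    (+-cong (≈-refl {p + q}) (∷-cong ≡.refl (derivative-+ p q)))
    (+-exchange p q (0ℤ ∷ derivative p) (0ℤ ∷ derivative q))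

  derivative-· : ∀ a p → derivative (a · p) ≈ a · derivative p
  derivative-· a []      = ≈-refl
  derivative-· a (b ∷ p) = ≈-trans
    (+-cong (≈-refl {a · p}) (∷-cong (≡.sym (ℤ.*-zeroʳ a)) (derivative-· a p)))
    (≈-sym (·-distribˡ a p (0ℤ ∷ derivative p)))

  derivative-* : ∀ p q → derivative (p * q) ≈ derivative p * q + p * derivative q
  derivative-* []      q = ≈-refl
  derivative-* (a ∷ p) q = begin
    derivative (a · q + (0ℤ ∷ p * q))
      ≈⟨ derivative-+ (a · q) (0ℤ ∷ p * q) ⟩
    derivative (a · q) + (p * q + (0ℤ ∷ derivative (p * q)))
      ≈⟨ +-cong (derivative-· a q) (+-cong (≈-refl {p * q}) (begin
           0ℤ ∷ derivative (p * q)                     ≈⟨ ∷-cong ≡.refl (derivative-* p q) ⟩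
           (0ℤ ∷ p′ * q) + (0ℤ ∷ p * q′)               ≈⟨ +-cong (≈-sym (0∷-* p′ q)) ≈-refl ⟩
           (0ℤ ∷ p′) * q + (0ℤ ∷ p * q′)               ∎)) ⟩
    a · q′ + (p * q + ((0ℤ ∷ p′) * q + (0ℤ ∷ p * q′)))
      -- Regrouped so that `p * q` joins the term in `p′`, since `derivative (a ∷ p)` is
      -- `p + (0ℤ ∷ p′)`.
      ≈⟨ solve 4 (λ x y z t → x :+ (y :+ (z :+ t)) := (y :+ z) :+ (x :+ t)) ≈-refl
           (a · q′) (p * q) ((0ℤ ∷ p′) * q) (0ℤ ∷ p * q′) ⟩
    (p * q + (0ℤ ∷ p′) * q) + (a · q′ + (0ℤ ∷ p * q′))
      ≈⟨ +-cong (*-distribʳ q p (0ℤ ∷ p′)) ≈-refl ⟨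
    derivative (a ∷ p) * q + (a ∷ p) * q′ ∎
    where
    p′ q′ : Poly
    p′ = derivative p
    q′ = derivative q

  derivative-^ : ∀ p k → derivative (p ^ suc k) ≈ [ + suc k ] * (p ^ k * derivative p)
  derivative-^ p zero = begin
    derivative (p * 1#)                ≈⟨ derivative-cong (p * 1#) p (*-identityʳ p) ⟩
    derivative p                       ≈⟨ *-identityˡ (derivative p) ⟨
    1# * derivative p                  ≈⟨ *-identityˡ (1# * derivative p) ⟨
    1# * (1# * derivative p)           ∎
  derivative-^ p (suc k) = begin
    derivative (p * p ^ suc k)
      ≈⟨ derivative-* p (p ^ suc k) ⟩
    derivative p * p ^ suc k + p * derivative (p ^ suc k)
      ≈⟨ +-cong ≈-refl (*-congˡ p (derivative-^ p k)) ⟩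
    derivative p * (p * p ^ k) + p * ([ + suc k ] * (p ^ k * derivative p))
      -- The constant `[ + suc (suc k) ]` computes from `1# + [ + suc k ]`, which is the factor
      -- `con 1 :+ c`.
      ≈⟨ solve 4 (λ x y z c → z :* (x :* y) :+ x :* (c :* (y :* z))
           := (con 1 :+ c) :* ((x :* y) :* z)) ≈-refl p (p ^ k) (derivative p) [ + suc k ] ⟩
    [ + suc (suc k) ] * (p ^ suc k * derivative p) ∎

  -- For `k = 0` the default exponent `pred 0` occurs with coefficient 0.
  derivative-X^ : ∀ k → derivative (X ^ k) ≈ (+ k) · X ^ pred k
  derivative-X^ zero    = ≈-refl
  derivative-X^ (suc k) = begin
    derivative (X ^ suc k)               ≈⟨ derivative-^ X k ⟩
    [ + suc k ] * (X ^ k * derivative X) ≈⟨ *-congˡ [ + suc k ] (*-congˡ (X ^ k) X′≈1) ⟩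
    [ + suc k ] * (X ^ k * 1#)           ≈⟨ *-congˡ [ + suc k ] (*-identityʳ (X ^ k)) ⟩
    [ + suc k ] * X ^ k                  ≈⟨ [a]*p≈a·p (+ suc k) (X ^ k) ⟩
    (+ suc k) · X ^ k                    ∎
    where
    X′≈1 : derivative X ≈ 1#
    X′≈1 = mk≈ λ { 0 → ≡.refl ; 1 → ≡.refl ; (suc (suc _)) → ≡.refl }

  derivative-[1-X] : derivative (1# - X) ≈ [ -1ℤ ]
  derivative-[1-X] = mk≈ λ { 0 → ≡.refl ; 1 → ≡.refl ; (suc (suc _)) → ≡.refl }

-- Finite sums of polynomials and double counting.

module FiniteSums where
  open P

  sumOver-cong : ∀ {A : Set} (xs : List A) {f g : A → Poly} →
    (∀ x → f x ≈ g x) → sumOver xs f ≈ sumOver xs g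
  sumOver-cong []       e = ≈-refl
  sumOver-cong (x ∷ xs) e = +-cong (e x) (sumOver-cong xs e)

  sumOver-+ : ∀ {A : Set} (xs : List A) (f g : A → Poly) →
    sumOver xs (λ x → f x + g x) ≈ sumOver xs f + sumOver xs g
  sumOver-+ []       f g = ≈-refl
  sumOver-+ (x ∷ xs) f g = ≈-trans (+-cong (≈-refl {f x + g x}) (sumOver-+ xs f g))
    (+-exchange (f x) (g x) (sumOver xs f) (sumOver xs g))

  sumOver-++ : ∀ {A : Set} (xs ys : List A) (f : A → Poly) →
    sumOver (xs ++ ys) f ≈ sumOver xs f + sumOver ys f
  sumOver-++ []       ys f = ≈-refl
  sumOver-++ (x ∷ xs) ys f = ≈-trans (+-cong (≈-refl {f x}) (sumOver-++ xs ys f))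
    (≈-sym (+-assoc (f x) (sumOver xs f) (sumOver ys f)))

  sumOver-map : ∀ {A B : Set} (g : A → B) (xs : List A) (f : B → Poly) →
    sumOver (map g xs) f ≡ sumOver xs (f ∘ g)
  sumOver-map g []       f = ≡.refl
  sumOver-map g (x ∷ xs) f = ≡.cong (_+_ (f (g x))) (sumOver-map g xs f)

  -- Moves the dependence on the complex from the index list into the summand, so that double
  -- counting can run over all subsets.
  sumOver-filter : ∀ {A : Set} {Q : Pred A 0ℓ} (Q? : Decidable Q) (xs : List A) (f : A → Poly) →
    sumOver (filter Q? xs) f ≈ sumOver xs (λ x → if does (Q? x) then f x else 0#)
  sumOver-filter Q? []       f = ≈-refl
  sumOver-filter Q? (x ∷ xs) f with does (Q? x)
  ... | true  = +-cong (≈-refl {f x}) (sumOver-filter Q? xs f)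
  ... | false = sumOver-filter Q? xs f

  sumOver-≈0 : ∀ {A : Set} (xs : List A) {f : A → Poly} → (∀ x → f x ≈ 0#) → sumOver xs f ≈ 0#
  sumOver-≈0 []       e = ≈-refl
  sumOver-≈0 (x ∷ xs) e = +-cong (e x) (sumOver-≈0 xs e)

  -- Used for the two additive maps `derivative` and `hFrom e`.
  sumOver-homo : ∀ {A : Set} (φ : Poly → Poly) → φ 0# ≈ 0# → (∀ p q → φ (p + q) ≈ φ p + φ q) →
    (xs : List A) (f : A → Poly) → φ (sumOver xs f) ≈ sumOver xs (φ ∘ f)
  sumOver-homo φ φ0 φ+ []       f = φ0
  sumOver-homo φ φ0 φ+ (x ∷ xs) f = ≈-trans (φ+ (f x) (sumOver xs f))
    (+-cong (≈-refl {φ (f x)}) (sumOver-homo φ φ0 φ+ xs f))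

  sumOver-allFin : ∀ n (f : Fin (suc n) → Poly) →
    sumOver (allFin (suc n)) f ≡ f zero + sumOver (allFin n) (f ∘ suc)
  sumOver-allFin n f = ≡.cong (_+_ (f zero)) (≡.trans
    (≡.cong (λ xs → sumOver xs f) (≡.sym (map-tabulate id suc)))
    (sumOver-map suc (allFin n) f))

  sumOver-subsets : ∀ n (f : Subset (suc n) → Poly) → sumOver (subsets (suc n)) f ≈
    sumOver (subsets n) (f ∘ (outside ∷_)) + sumOver (subsets n) (f ∘ (inside ∷_))
  sumOver-subsets n f = begin
    sumOver (subsets (suc n)) f
      ≈⟨ sumOver-++ (map (outside ∷_) (subsets n)) (map (inside ∷_) (subsets n)) f ⟩
    sumOver (map (outside ∷_) (subsets n)) f + sumOver (map (inside ∷_) (subsets n)) f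
      ≡⟨ ≡.cong₂ _+_ (sumOver-map (outside ∷_) (subsets n) f) (sumOver-map (inside ∷_) (subsets n) f) ⟩
    sumOver (subsets n) (f ∘ (outside ∷_)) + sumOver (subsets n) (f ∘ (inside ∷_)) ∎

  -- Reindexes `g` along the map from `G` to `G ∪ ⁅ p ⁆`. The value 0 on sets containing `p` makes
  -- each `F` with `p ∈ F` arise exactly once, from `F` without `p`.
  extend : ∀ {n} → (Subset n → Poly) → Fin n → Subset n → Poly
  extend g p G = if does (¬? (p Sub.∈? G)) then g (G ∪ ⁅ p ⁆) else 0#

  -- Double counting of the pairs p ∈ F, with G = F \ p.
  sumOver-extend : ∀ n (g : Subset n → Poly) →
    sumOver (allFin n) (λ p → sumOver (subsets n) (extend g p)) ≈
    sumOver (subsets n) (λ F → (+ ∣ F ∣) · g F)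
  sumOver-extend zero    g = ≈-sym (+-cong (0·-≈0 (g [])) ≈-refl)
  sumOver-extend (suc n) g = begin
    sumOver (allFin (suc n)) (λ p → sumOver (subsets (suc n)) (extend g p))
      ≡⟨ sumOver-allFin n (λ p → sumOver (subsets (suc n)) (extend g p)) ⟩
    sumOver (subsets (suc n)) (extend g zero)
      + sumOver (allFin n) (λ p → sumOver (subsets (suc n)) (extend g (suc p)))
      -- Induction on the ground set. Removing `zero` counts each `inside ∷ F` once; this extra copy
      -- of the sum of `gᵢ` raises its multiplicity from `∣ F ∣` to `suc ∣ F ∣`.
      ≈⟨ +-cong at-zero at-suc ⟩
    sumOver (subsets n) gᵢ
      + (sumOver (subsets n) (λ F → (+ ∣ F ∣) · gₒ F) + sumOver (subsets n) (λ F → (+ ∣ F ∣) · gᵢ F))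
      ≈⟨ solve 3 (λ x y z → x :+ (y :+ z) := y :+ (x :+ z)) ≈-refl (sumOver (subsets n) gᵢ)
           (sumOver (subsets n) λ F → (+ ∣ F ∣) · gₒ F) (sumOver (subsets n) λ F → (+ ∣ F ∣) · gᵢ F) ⟩
    sumOver (subsets n) (λ F → (+ ∣ F ∣) · gₒ F)
      + (sumOver (subsets n) gᵢ + sumOver (subsets n) (λ F → (+ ∣ F ∣) · gᵢ F))
      ≈⟨ +-cong ≈-refl (≈-trans
           (≈-sym (sumOver-+ (subsets n) gᵢ (λ F → (+ ∣ F ∣) · gᵢ F)))
           (sumOver-cong (subsets n) suc-·)) ⟩
    sumOver (subsets n) (λ F → (+ ∣ F ∣) · gₒ F) + sumOver (subsets n) (λ F → (+ suc ∣ F ∣) · gᵢ F)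
      ≈⟨ sumOver-subsets n (λ F → (+ ∣ F ∣) · g F) ⟨
    sumOver (subsets (suc n)) (λ F → (+ ∣ F ∣) · g F) ∎
    where
    gₒ gᵢ : Subset n → Poly
    gₒ F = g (outside ∷ F)
    gᵢ F = g (inside ∷ F)

    suc-· : ∀ F → gᵢ F + (+ ∣ F ∣) · gᵢ F ≈ (+ suc ∣ F ∣) · gᵢ F
    suc-· F = ≈-sym (≈-trans (·-distribʳ (+ 1) (+ ∣ F ∣) (gᵢ F)) (+-cong (1·-≈ (gᵢ F)) ≈-refl))

    at-zero : sumOver (subsets (suc n)) (extend g zero) ≈ sumOver (subsets n) gᵢ
    at-zero = begin
      sumOver (subsets (suc n)) (extend g zero)
        ≈⟨ sumOver-subsets n (extend g zero) ⟩
      -- `⁅ zero ⁆` is `inside ∷ ⊥`, hence the union with `⊥` on the tail. Sets with head `inside`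
      -- already contain `zero` and give 0.
      sumOver (subsets n) (λ G → gᵢ (G ∪ ⊥)) + sumOver (subsets n) (λ _ → 0#)
        ≈⟨ +-cong (sumOver-cong (subsets n) λ G → mk≈ λ k →
                    ≡.cong (λ F → coeff (gᵢ F) k) (Sub.∪-identityʳ G))
                  (sumOver-≈0 (subsets n) λ _ → ≈-refl) ⟩
      sumOver (subsets n) gᵢ + 0#
        ≈⟨ +-identityʳ _ ⟩
      sumOver (subsets n) gᵢ ∎

    at-suc : sumOver (allFin n) (λ p → sumOver (subsets (suc n)) (extend g (suc p))) ≈
      sumOver (subsets n) (λ F → (+ ∣ F ∣) · gₒ F) + sumOver (subsets n) (λ F → (+ ∣ F ∣) · gᵢ F)
    at-suc = begin
      sumOver (allFin n) (λ p → sumOver (subsets (suc n)) (extend g (suc p)))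
        -- Adding `suc p` keeps the head of a subset, so `extend g (suc p)` computes to
        -- `extend gₒ p` and `extend gᵢ p` on the two halves.
        ≈⟨ sumOver-cong (allFin n) (λ p → sumOver-subsets n (extend g (suc p))) ⟩
      sumOver (allFin n) (λ p → sumOver (subsets n) (extend gₒ p) + sumOver (subsets n) (extend gᵢ p))
        ≈⟨ sumOver-+ (allFin n) (λ p → sumOver (subsets n) (extend gₒ p))
                                (λ p → sumOver (subsets n) (extend gᵢ p)) ⟩
      sumOver (allFin n) (λ p → sumOver (subsets n) (extend gₒ p))
        + sumOver (allFin n) (λ p → sumOver (subsets n) (extend gᵢ p))
        ≈⟨ +-cong (sumOver-extend n gₒ) (sumOver-extend n gᵢ) ⟩
      sumOver (subsets n) (λ F → (+ ∣ F ∣) · gₒ F) + sumOver (subsets n) (λ F → (+ ∣ F ∣) · gᵢ F) ∎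

-- The derivative of the f-polynomial as a sum over links.

module LinkSum {n} (Δ : SimplicialComplex n) where
  open P
  open PolynomialLemmas
  open FiniteSums
  open SimplicialComplex Δ using (Face; Face?; down-closed)

  -- fPolynomial (link Δ p v) without the proof v that p is a vertex.
  linkPolynomial : Fin n → Poly
  linkPolynomial p =
    sumOver (filter (λ G → Face? (G ∪ ⁅ p ⁆) ×-dec ¬? (p Sub.∈? G)) (subsets n)) (λ G → X ^ ∣ G ∣)

  -- The exponent is the size of `F` with one vertex removed; at the empty set the default `pred 0`
  -- meets only the multiplicity 0.
  weight : Subset n → Poly
  weight F = if does (Face? F) then X ^ pred ∣ F ∣ else 0#

  ∣G∪⁅p⁆∣ : ∀ {m} (p : Fin m) G → p ∉ G → ∣ G ∪ ⁅ p ⁆ ∣ ≡ suc ∣ G ∣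
  ∣G∪⁅p⁆∣ zero    (inside  ∷ G) p∉G = contradiction here p∉G
  ∣G∪⁅p⁆∣ zero    (outside ∷ G) p∉G = ≡.cong (suc ∘ ∣_∣) (Sub.∪-identityʳ G)
  ∣G∪⁅p⁆∣ (suc p) (inside  ∷ G) p∉G = ≡.cong suc (∣G∪⁅p⁆∣ p G (p∉G ∘ there))
  ∣G∪⁅p⁆∣ (suc p) (outside ∷ G) p∉G = ∣G∪⁅p⁆∣ p G (p∉G ∘ there)

  -- If `p ∉ G`, then `G ∪ ⁅ p ⁆` has one element more than `G`, so the `pred` in `weight` restores
  -- the exponent `∣ G ∣`.
  linkPolynomial≈ : ∀ p → linkPolynomial p ≈ sumOver (subsets n) (extend weight p)
  linkPolynomial≈ p = ≈-trans (sumOver-filter _ (subsets n) (λ G → X ^ ∣ G ∣))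
    (sumOver-cong (subsets n) pointwise)
    where
    pointwise : ∀ G → (if does (Face? (G ∪ ⁅ p ⁆) ×-dec ¬? (p Sub.∈? G)) then X ^ ∣ G ∣ else 0#)
      ≈ extend weight p G
    pointwise G with p Sub.∈? G | does (Face? (G ∪ ⁅ p ⁆))
    ... | yes _   | true  = ≈-refl
    ... | yes _   | false = ≈-refl
    ... | no _    | false = ≈-refl
    ... | no  p∉G | true  rewrite ∣G∪⁅p⁆∣ p G p∉G = ≈-refl

  -- If `G ∪ ⁅ p ⁆` were a face, its subset `⁅ p ⁆` would be one too. Hence sums over vertices can
  -- be extended to all of `Fin n`.
  linkPolynomial-nonVertex : ∀ p → ¬ Vertex Δ p → linkPolynomial p ≈ 0#
  linkPolynomial-nonVertex p ¬v = ≈-trans (sumOver-filter _ (subsets n) (λ G → X ^ ∣ G ∣))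
    (sumOver-≈0 (subsets n) pointwise)
    where
    pointwise : ∀ G →
      (if does (Face? (G ∪ ⁅ p ⁆) ×-dec ¬? (p Sub.∈? G)) then X ^ ∣ G ∣ else 0#) ≈ 0#
    pointwise G with Face? (G ∪ ⁅ p ⁆)
    ... | yes G∪p∈Δ = contradiction (down-closed (Sub.q⊆p∪q G ⁅ p ⁆) G∪p∈Δ) ¬v
    ... | no _      = ≈-refl

  derivative-fPolynomial : derivative (fPolynomial Δ) ≈ sumOver (allFin n) linkPolynomial
  derivative-fPolynomial = begin
    derivative (fPolynomial Δ)
      ≈⟨ sumOver-homo derivative ≈-refl derivative-+ (faces Δ) (λ F → X ^ ∣ F ∣) ⟩
    sumOver (faces Δ) (λ F → derivative (X ^ ∣ F ∣))
      ≈⟨ sumOver-filter Face? (subsets n) (λ F → derivative (X ^ ∣ F ∣)) ⟩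
    sumOver (subsets n) (λ F → if does (Face? F) then derivative (X ^ ∣ F ∣) else 0#)
      ≈⟨ sumOver-cong (subsets n) pointwise ⟩
    sumOver (subsets n) (λ F → (+ ∣ F ∣) · weight F)
      ≈⟨ sumOver-extend n weight ⟨
    sumOver (allFin n) (λ p → sumOver (subsets n) (extend weight p))
      ≈⟨ sumOver-cong (allFin n) linkPolynomial≈ ⟨
    sumOver (allFin n) linkPolynomial ∎
    where
    pointwise : ∀ F → (if does (Face? F) then derivative (X ^ ∣ F ∣) else 0#) ≈ (+ ∣ F ∣) · weight F
    pointwise F with does (Face? F)
    ... | true  = derivative-X^ ∣ F ∣
    ... | false = ≈-refl

-- The linear map from f-polynomials to h-polynomials.

module HTransform where
  open P
  open PolynomialLemmas

  -- Both specifications cross-multiply to equations with the same right side and the same nonzero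
  -- denominator, which cancels.
  IsHPolynomial-unique : ∀ {n} d (Δ : SimplicialComplex n) {h h′} →
    IsHPolynomial d Δ h → IsHPolynomial d Δ h′ → h ≈ h′
  IsHPolynomial-unique d Δ (RationalFunction.mk≈ e) (RationalFunction.mk≈ e′) =
    *-cancelʳ _ (RationalFunction.RatFun.den≉0
      (ι ((1# - X) ^ d) RationalFunction.* evaluate (fPolynomial Δ) w/⟨1-w⟩)) (≈-trans e (≈-sym e′))

  -- Replaces an arbitrary h-polynomial by the explicit Horner form, on which derivatives can be
  -- computed.
  ≈hFrom : ∀ {n} d (Δ : SimplicialComplex n) {h} →
    (∀ F → SimplicialComplex.Face Δ F → ∣ F ∣ ≤ d) → IsHPolynomial d Δ h → h ≈ hFrom d (fPolynomial Δ)
  ≈hFrom d Δ bound h-spec = IsHPolynomial-unique d Δ h-spec (proj₂ (hPolynomial-exists d Δ bound))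

  hFrom-≈0 : ∀ d p → p ≈ 0# → hFrom d p ≈ 0#
  hFrom-≈0 d       []      e = ≈-refl
  hFrom-≈0 zero    (a ∷ p) e = [a]≈0 (coeff-≡ e 0)
  hFrom-≈0 (suc d) (a ∷ p) e = +-cong
    (*-congʳ ((1# - X) ^ suc d) ([a]≈0 (coeff-≡ e 0)))
    (≈-trans (*-congˡ X (hFrom-≈0 d p (mk≈ λ k → coeff-≡ e (suc k)))) (*-zeroʳ X))

  -- `hFrom` recurses on coefficient lists, while `≈` ignores trailing zeros; the cases with one
  -- empty list reduce to `hFrom-≈0`.
  hFrom-cong : ∀ d p q → p ≈ q → hFrom d p ≈ hFrom d q
  hFrom-cong d       []      q       e = ≈-sym (hFrom-≈0 d q (≈-sym e))
  hFrom-cong d       (a ∷ p) []      e = hFrom-≈0 d (a ∷ p) e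
  hFrom-cong zero    (a ∷ p) (b ∷ q) e = ∷-cong (coeff-≡ e 0) ≈-refl
  hFrom-cong (suc d) (a ∷ p) (b ∷ q) e = +-cong
    (*-congʳ ((1# - X) ^ suc d) (∷-cong (coeff-≡ e 0) (≈-refl {[]})))
    (*-congˡ X (hFrom-cong d p q (tail-≈ e)))

  hFrom-+ : ∀ d p q → hFrom d (p + q) ≈ hFrom d p + hFrom d q
  hFrom-+ d       []      q       = ≈-refl
  hFrom-+ d       (a ∷ p) []      = ≈-sym (+-identityʳ _)
  hFrom-+ zero    (a ∷ p) (b ∷ q) = ≈-refl
  hFrom-+ (suc d) (a ∷ p) (b ∷ q) = begin
    ([ a ] + [ b ]) * v + X * hFrom d (p + q)
      ≈⟨ +-cong (≈-refl {([ a ] + [ b ]) * v}) (*-congˡ X (hFrom-+ d p q)) ⟩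
    ([ a ] + [ b ]) * v + X * (hFrom d p + hFrom d q)
      ≈⟨ solve 6 (λ a b v x g k → (a :+ b) :* v :+ x :* (g :+ k)
           := (a :* v :+ x :* g) :+ (b :* v :+ x :* k)) ≈-refl [ a ] [ b ] v X (hFrom d p) (hFrom d q) ⟩
    hFrom (suc d) (a ∷ p) + hFrom (suc d) (b ∷ q) ∎
    where
    v : Poly
    v = (1# - X) ^ suc d

  -- Raising the exponent k and the bound d together leaves the factor (1-w)^(d-k) unchanged.
  hFrom-0∷ : ∀ d p → hFrom (suc d) (0ℤ ∷ p) ≈ X * hFrom d p
  hFrom-0∷ d p = +-cong
    (*-congʳ ((1# - X) ^ suc d) ([a]≈0 ≡.refl)) (≈-refl {X * hFrom d p})

  -- One step of Horner's scheme for h = a uᵉ⁺¹ + w g, where u = 1 - w.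
  horner-derivative : ∀ e a g k → (1# - X) * derivative g + [ + e ] * g ≈ k →
    (1# - X) * derivative ([ a ] * (1# - X) ^ suc e + X * g)
      + [ + suc e ] * ([ a ] * (1# - X) ^ suc e + X * g)
    ≈ g + X * k
  horner-derivative e a g k ih = begin
    u * derivative ([ a ] * (u * v) + X * g) + [ + suc e ] * ([ a ] * (u * v) + X * g)
      ≈⟨ +-cong (*-congˡ u h′) ≈-refl ⟩
    u * ([ a ] * ((1# + c) * (v * m)) + (g + X * g′)) + (1# + c) * ([ a ] * (u * v) + X * g)
      -- The solver has natural coefficients, so -1 enters as the variable `m`. The terms in `a`
      -- collect into the factor `1# + m`, which vanishes in the next step, where also `u + X`
      -- becomes 1.
      ≈⟨ solve 8 (λ u a c v m g x g′ →
           u :* (a :* ((con 1 :+ c) :* (v :* m)) :+ (g :+ x :* g′))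
             :+ (con 1 :+ c) :* (a :* (u :* v) :+ x :* g)
           := (con 1 :+ m) :* (a :* (con 1 :+ c) :* (u :* v))
             :+ ((u :+ x) :* g :+ x :* (u :* g′ :+ c :* g)))
           ≈-refl u [ a ] c v m g X g′ ⟩
    (1# + m) * ([ a ] * (1# + c) * (u * v)) + ((u + X) * g + X * (u * g′ + c * g))
      ≈⟨ +-cong (*-congʳ ([ a ] * (1# + c) * (u * v)) ([a]≈0 ≡.refl))
           (+-cong (≈-trans (*-congʳ g [1-X]+X≈1) (*-identityˡ g)) (*-congˡ X ih)) ⟩
    g + X * k ∎
    where
    u v m c g′ : Poly
    u = 1# - X
    v = u ^ e
    m = [ -1ℤ ]
    c = [ + e ]
    g′ = derivative g

    h′ : derivative ([ a ] * (u * v) + X * g) ≈ [ a ] * ((1# + c) * (v * m)) + (g + X * g′)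
    h′ = begin
      derivative ([ a ] * (u * v) + X * g)
        ≈⟨ derivative-+ ([ a ] * (u * v)) (X * g) ⟩
      derivative ([ a ] * (u * v)) + derivative (X * g)
        -- The two products become a scalar multiple and a shift, whose derivatives need no product
        -- rule.
        ≈⟨ +-cong
             (≈-trans (derivative-cong ([ a ] * (u * v)) (a · (u * v)) ([a]*p≈a·p a (u * v)))
               (≈-trans (derivative-· a (u * v)) (≈-sym ([a]*p≈a·p a (derivative (u * v))))))
             (derivative-cong (X * g) (0ℤ ∷ g) (X*p≈0∷p g)) ⟩
      [ a ] * derivative (u ^ suc e) + (g + (0ℤ ∷ g′))
        ≈⟨ +-cong
             (*-congˡ [ a ] (≈-trans (derivative-^ u e)
               (*-congˡ [ + suc e ] (*-congˡ v derivative-[1-X]))))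
             (+-cong (≈-refl {g}) (≈-sym (X*p≈0∷p g′))) ⟩
      [ a ] * ([ + suc e ] * (v * m)) + (g + X * g′) ∎

  -- Induction along Horner's scheme: `horner-derivative` turns the identity for `p` into T_e(p) + w
  -- T_(e-1)(p′), which is T_e(p + w p′) by linearity, and p + w p′ is the derivative of a + w p.
  hFrom-derivative : ∀ e p →
    (1# - X) * derivative (hFrom (suc e) p) + [ + suc e ] * hFrom (suc e) p ≈ hFrom e (derivative p)
  hFrom-derivative e       []      = +-cong (*-zeroʳ (1# - X)) (*-zeroʳ [ + suc e ])
  -- `hFrom 0 p` is constant, so 0 takes the place of T_(e-1)(p′). On the other side `hFrom 0` keeps
  -- only the constant term, to which w p′ contributes 0.
  hFrom-derivative zero    (a ∷ p) = ≈-trans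
    (horner-derivative 0 a (hFrom 0 p) 0# (begin
      (1# - X) * derivative (hFrom 0 p) + [ 0ℤ ] * hFrom 0 p
        ≈⟨ +-cong (*-congˡ (1# - X) (constant p))
             (*-congʳ (hFrom 0 p) ([a]≈0 ≡.refl)) ⟩
      (1# - X) * 0# + 0#
        ≈⟨ +-cong (*-zeroʳ (1# - X)) ≈-refl ⟩
      0# ∎))
    (≈-trans (+-cong (≈-refl {hFrom 0 p}) (*-zeroʳ X))
    (≈-sym (≈-trans (hFrom-+ 0 p (0ℤ ∷ derivative p)) (+-cong (≈-refl {hFrom 0 p}) (0∷-≈0 ≈-refl)))))
    where
    constant : ∀ p → derivative (hFrom 0 p) ≈ 0#
    constant []      = ≈-refl
    constant (b ∷ p) = 0∷-≈0 ≈-refl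
  hFrom-derivative (suc e) (a ∷ p) = begin
    (1# - X) * derivative (hFrom (suc (suc e)) (a ∷ p))
        + [ + suc (suc e) ] * hFrom (suc (suc e)) (a ∷ p)
      ≈⟨ horner-derivative (suc e) a (hFrom (suc e) p) _ (hFrom-derivative e p) ⟩
    hFrom (suc e) p + X * hFrom e (derivative p)
      ≈⟨ +-cong (≈-refl {hFrom (suc e) p}) (≈-sym (hFrom-0∷ e (derivative p))) ⟩
    hFrom (suc e) p + hFrom (suc e) (0ℤ ∷ derivative p)
      ≈⟨ hFrom-+ (suc e) p (0ℤ ∷ derivative p) ⟨
    hFrom (suc e) (derivative (a ∷ p)) ∎

-- The sum of the h-polynomials of the vertex links.

module LinkHPolynomials {n} (Δ : SimplicialComplex n) where
  open P
  open FiniteSums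
  open LinkSum Δ
  open HTransform
  open SimplicialComplex Δ using (Face; Face?)

  sumOver-vertices : ∀ e → (∀ F → Face F → ∣ F ∣ ≤ suc e) → (hlk : Fin n → Poly) →
    (∀ p (v : Vertex Δ p) → IsHPolynomial e (link Δ p v) (hlk p)) →
    sumOver (vertices Δ) hlk ≈ hFrom e (derivative (fPolynomial Δ))
  sumOver-vertices e bound hlk hlk-spec = begin
    sumOver (vertices Δ) hlk
      ≈⟨ sumOver-filter (λ p → Face? ⁅ p ⁆) (allFin n) hlk ⟩
    sumOver (allFin n) (λ p → if does (Face? ⁅ p ⁆) then hlk p else 0#)
      ≈⟨ sumOver-cong (allFin n) pointwise ⟩
    sumOver (allFin n) (λ p → hFrom e (linkPolynomial p))
      ≈⟨ sumOver-homo (hFrom e) ≈-refl (hFrom-+ e) (allFin n) linkPolynomial ⟨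
    hFrom e (sumOver (allFin n) linkPolynomial)
      ≈⟨ hFrom-cong e (derivative (fPolynomial Δ)) _ derivative-fPolynomial ⟨
    hFrom e (derivative (fPolynomial Δ)) ∎
    where
    pointwise : ∀ p →
      (if does (Face? ⁅ p ⁆) then hlk p else 0#) ≈ hFrom e (linkPolynomial p)
    pointwise p with Face? ⁅ p ⁆
    -- `link-bound` gives the bound `suc e ∸ 1`, which is `e`, and `fPolynomial (link Δ p v)`
    -- unfolds to `linkPolynomial p`.
    ... | yes v = ≈hFrom e (link Δ p v) (link-bound (suc e) Δ p v bound) (hlk-spec p v)
    ... | no ¬v = ≈-sym (hFrom-≈0 e (linkPolynomial p) (linkPolynomial-nonVertex p ¬v))

-- Division by 1-w and the final identity.

module Conclusion where
  open P
  open PolynomialLemmas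
  open HTransform

  -- Equality of fractions is cross-multiplied, so only `d · h` has to be moved to the other side.
  ≈/[1-X] : ∀ p d h s → (1# - X) * p + d · h ≈ s →
    ι p RationalFunction.≈ 1/⟨1-w⟩ RationalFunction.* ι (s - d · h)
  ≈/[1-X] p d h s e = RationalFunction.mk≈ (begin
    p * ((1# - X) * 1#)
      ≈⟨ solve 2 (λ p u → p :* (u :* con 1) := u :* p :+ con 0) ≈-refl p (1# - X) ⟩
    (1# - X) * p + 0#
      ≈⟨ +-cong (≈-refl {(1# - X) * p}) (+-inverseʳ (d · h)) ⟨
    (1# - X) * p + (d · h - d · h)
      ≈⟨ +-assoc ((1# - X) * p) (d · h) (- (d · h)) ⟨
    (1# - X) * p + d · h - d · h
      ≈⟨ +-cong e ≈-refl ⟩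
    s - d · h
      ≈⟨ *-identityˡ (s - d · h) ⟨
    1# * (s - d · h)
      ≈⟨ *-identityʳ (1# * (s - d · h)) ⟨
    1# * (s - d · h) * 1# ∎)

open Polynomial using (_-_; _·_)
open RationalFunction using (_≈_; _*_)

proposition1p12 : ∀ {n : ℕ} (Δ : SimplicialComplex n) (d : ℕ) → 1 ≤ d → HasDimension Δ (d ∸ 1) →
    (h : Poly) → IsHPolynomial d Δ h →
    (hlk : Fin n → Poly) → (∀ p (v : Vertex Δ p) → IsHPolynomial (d ∸ 1) (link Δ p v) (hlk p)) →
    ι (derivative h) ≈ 1/⟨1-w⟩ * ι (sumOver (vertices Δ) hlk - (+ d) · h)
-- With `d = suc e` the dimension `d ∸ 1` is `e`, so `bound` limits faces to `suc e` elements and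
-- the links use `hFrom e`.
proposition1p12 Δ (suc e) (s≤s _) (_ , bound) h h-spec hlk hlk-spec =
  Conclusion.≈/[1-X] (derivative h) (+ suc e) h (sumOver (vertices Δ) hlk) (begin
    (1# P.- X) P.* derivative h + (+ suc e) P.· h
      ≈⟨ +-cong (*-congˡ (1# P.- X) (derivative-cong h H h≈H))
           (≈-trans (·-cong {+ suc e} ≡.refl h≈H) (≈-sym ([a]*p≈a·p (+ suc e) H))) ⟩
    (1# P.- X) P.* derivative H + [ + suc e ] P.* H
      ≈⟨ hFrom-derivative e (fPolynomial Δ) ⟩
    hFrom e (derivative (fPolynomial Δ))
      ≈⟨ LinkHPolynomials.sumOver-vertices Δ e bound hlk hlk-spec ⟨
    sumOver (vertices Δ) hlk ∎)
  where
  open P hiding (_≈_; _*_; _-_; _·_)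
  open PolynomialLemmas
  open HTransform
  H : Poly
  H = hFrom (suc e) (fPolynomial Δ)
  h≈H : h P.≈ H
  h≈H = ≈hFrom (suc e) Δ bound h-spec
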